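{- Let $\varphi$ be a minimal counterexample to Vaught's conjecture and let $\lambda\in S^\circ=\mathfrak F\cap C_{5.3}\cap(\mathrm{qr}(\varphi),\omega_1)$. Then $|\mathrm{Spec}_\lambda|\le\aleph_0$, where $\mathrm{Spec}_\lambda=\{\mathrm{trace}(M):M\text{ a fiber model at }\lambda\}$.
   Context: Structures are countable structures in a countable vocabulary; classes of models are counted up to isomorphism. $\Sigma^{\mathrm{in}}_0=\Pi^{\mathrm{in}}_0$ is the set of finitary quantifier-free formulas; for $\alpha>0$, $\Sigma^{\mathrm{in}}_\alpha$ consists of countable disjunctions of formulas $\exists\bar x\,\psi$ with $\psi\in\Pi^{\mathrm{in}}_\beta$, $\beta<\alpha$, and $\Pi^{\mathrm{in}}_\alpha$ is dual. $M\equiv_\alpha N$: $M,N$ satisfy the same $\Pi^{\mathrm{in}}_\alpha$ (equivalently $\Sigma^{\mathrm{in}}_\alpha$) sentences. A Scott sentence of $M$ is an $L_{\omega_1\omega}$ sentence whose countable models are exactly the copies of $M$. $\mathrm{cSR}(M)$: the least $\alpha$ such that $M$ has a $\Pi^{\mathrm{in}}_{\alpha+1}$ Scott sentence. $\omega_1^A=\min\{\omega_1^X: X\in 2^\omega\text{ computes a copy of }A\}$. $\mathrm{qr}(S)$: the least $\beta$ with $S\in\Pi^{\mathrm{in}}_\beta\cup\Sigma^{\mathrm{in}}_\beta$. Standing hypotheses: Vaught's conjecture fails, and $\varphi$ is a minimal counterexample: an $L_{\omega_1\omega}$ sentence with exactly $\aleph_1$ countable models up to isomorphism, scattered (for each $\alpha<\omega_1$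 at most countably many $\equiv_\alpha$-classes among its models), and such that for every $L_{\omega_1\omega}$ sentence $\psi$ one of $\varphi\wedge\psi$, $\varphi\wedge\neg\psi$ has only countably many models. Moreover for each $\alpha<\omega_1$ only countably many $\Sigma^{\mathrm{in}}_\alpha$-types are realized in models of $\varphi$. For each $\beta<\omega_1$ exactly one $\equiv_\beta$-class of models of $\varphi$ is uncountable, denoted $\mathcal C_\beta$. $f(\alpha)=\min\{\beta:(\forall M\models\varphi)(M\notin\mathcal C_\alpha\Rightarrow\mathrm{cSR}(M)<\beta)\}$, $\mathfrak F=\{\alpha<\omega_1:f(\alpha)\le\alpha\}$. Sacks rank. A fragment is a countable set of $L_{\omega_1\omega}$ formulas closed under subformulas, substitution and the finitary connectives and quantifiers. For a structure $A$: $L^A_0$ is the finitary language; $T^A_\delta=\mathrm{Th}_{L^A_\delta}(A)$; $L^A_{\delta+1}$ is the least fragment containing $L^A_\delta$ and $\bigwedge p$ for every non-principal complete $L^A_\delta$-type $p$ realized in $A$; unions at limits. $\mathrm{sr}_{\mathrm{Sacks}}(A)$ is the least $\delta$ such that $A$ is the atomic model of $T^A_\delta$. Tree of nodes. $L_0$ is the fragment generated by $\varphi$, and $T$ is $\{\varphi\}$ together with the tautologies of $L_0$. A theory $T'$ in a fragment $L'$ is $\omega$-complete if for each sentence $F\in L'$, $F\in T'$ or $\neg F\in T'$, and whenever $\bigvee_iF_i\in T'$, some $F_i\in T'$; it is finitarily consistent if no contradiction is derivable from it by finite-length deductions. Nodes on level $0$: finitarily consistent $\omega$-complete extensions of $T$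 in $L_0$. An $n$-type of a node $S$ (in fragment $L_S$) is a maximal set of $L_S(\bar x)$-formulas finitarily consistent with $S$; it is principal if generated over $S$ by one of its formulas. Nodes on level $\delta+1$: finitarily consistent $\omega$-complete extensions of a level-$\delta$ node $S$ in $L'_S$, the least fragment containing $L_S$ and $\bigwedge p$ for each non-principal $n$-type $p$ of $S$. Nodes on limit levels: unions along chains. Every model of a node is a model of $\varphi$. Fixed data, supplied by a theorem of Sacks (Bounds on weak scattering, Prop. 5.2 and Thm. 5.3): an increasing branch $(T_\delta)_{\delta<\omega_1}$ of nodes, $T_\delta$ on level $\delta$, unions at limits, $\Delta_1$ over $L(\omega_1,T)$, such that every $T_\delta$ has an atomic model of $\mathrm{sr}_{\mathrm{Sacks}}$ exactly $\delta$; and a club $C_{5.3}\subseteq\omega_1$ (the ordinals $\omega_1^{L(\beta_\delta,T)}$ for the transitive collapses $L(\beta_\delta,T)$ of the $\Sigma_1$-hulls in Sacks' proof) such that for each $\lambda\in C_{5.3}$: $\lambda>\omega$ and $L(\lambda,T)$ is $\Sigma_1$-admissible; and the set of non-principal $n$-types of $T_\lambda$ is non-empty and countable. For $\lambda\in S^\circ$: $N$ is the set of non-principal $n$-types (all $n\ge1$) of $T_\lambda$. The fiber at $\lambda$ is the class of countable $M$ with $M\models T_\lambda$ and $\omega_1^M=\lambda$; its members are fiber models. For a fiber model $M$, $\mathrm{trace}(M)=\{p\in N:M\text{ realizes }p\}$. -}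

module Defs where

open import Level using (Level; 0ℓ; _⊔_) renaming (suc to lsuc)
open import Data.Bool using (Bool; if_then_else_)
open import Data.Empty using (⊥)
open import Data.Fin using (Fin; toℕ) renaming (zero to fzero; suc to fsuc)
open import Data.List using (List; []; _∷_; map)
open import Data.List.Membership.Propositional using (_∈_)
open import Data.List.Relation.Unary.All using (All)
open import Data.Maybe using (Maybe; maybe)
open import Data.Maybe.Relation.Unary.Any using (Any)
open import Data.Nat using (ℕ; zero; suc; _+_; _*_; _^_; _≤_; _<_)
open import Data.Product using (Σ; ∃; ∃-syntax; Σ-syntax; _×_; _,_; proj₁; proj₂)
open import Data.Sum using (_⊎_)
open import Data.Unit using (⊤)
open import Data.Vec using (Vec; []; _∷_; lookup; tabulate; toList) renaming (map to mapᵛ)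
open import Function using (_∘_; _⇔_; _↔_; Inverse; Injective)
open import Relation.Binary.PropositionalEquality using (_≡_)
open import Relation.Nullary using (¬_)
open import Relation.Unary using (Pred; _∪_; ｛_｝; _⊆_; _≐_)

private variable
  a p r : Level
  m n k : ℕ

-- Being enumerated, up to _~_, by a partial function on ℕ; finite and empty
-- classes are included.
AtMostCountable : {A : Set a} → (A → A → Set r) → Pred A p → Set (a ⊔ r ⊔ p)
AtMostCountable {A = A} _~_ P =
  Σ[ e ∈ (ℕ → Maybe (Σ A P)) ]
    (∀ x → P x → ∃[ i ] Any (λ y → x ~ proj₁ y) (e i))

-- Notations for countable ordinals; lim f is the supremum of the f i, with f
-- not required to be increasing.  The countable ordinals are these trees
-- modulo _≈ᵒ_.
data Ord : Set where
  zero : Ord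
  suc  : Ord → Ord
  lim  : (ℕ → Ord) → Ord

infix 4 _≤ᵒ_ _<ᵒ_ _≈ᵒ_

_≤ᵒ_ : Ord → Ord → Set
_<ᵒ_ : Ord → Ord → Set

zero  ≤ᵒ β = ⊤
suc α ≤ᵒ β = α <ᵒ β
lim f ≤ᵒ β = ∀ i → f i ≤ᵒ β

α <ᵒ zero  = ⊥
α <ᵒ suc β = α ≤ᵒ β
α <ᵒ lim f = ∃[ i ] α <ᵒ f i

_≈ᵒ_ : Ord → Ord → Set
α ≈ᵒ β = α ≤ᵒ β × β ≤ᵒ α

finite : ℕ → Ord
finite zero    = zero
finite (suc i) = suc (finite i)

ω : Ord
ω = lim finite

IsLimit : Ord → Set
IsLimit δ = zero <ᵒ δ × (∀ α → α <ᵒ δ → suc α <ᵒ δ)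

IsLeast : Pred Ord p → Pred Ord p
IsLeast P α = P α × (∀ β → P β → α ≤ᵒ β)

record IsClub (C : Pred Ord 0ℓ) : Set where
  field
    respects  : ∀ {α β} → α ≈ᵒ β → C α → C β
    unbounded : ∀ α → ∃[ β ] (C β × α <ᵒ β)
    closed    : ∀ δ → IsLimit δ →
                (∀ α → α <ᵒ δ → ∃[ β ] (C β × α <ᵒ β × β <ᵒ δ)) → C δ

data Program : ℕ → Set where
  zer    : Program n
  succ   : Program 1
  proj   : Fin n → Program n
  oracle : Program 1
  comp   : Program k → Vec (Program n) k → Program n
  prec   : Program n → Program (2 + n) → Program (1 + n)
  mu     : Program (1 + n) → Program n

infix 4 _⊢_[_]⇓_

data _⊢_[_]⇓_ (X : ℕ → Bool) : ∀ {n} → Program n → Vec ℕ n → ℕ → Set where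
  zer    : ∀ {n} {v : Vec ℕ n} → X ⊢ zer [ v ]⇓ 0
  succ   : ∀ {x} → X ⊢ succ [ x ∷ [] ]⇓ suc x
  proj   : ∀ {n} {v : Vec ℕ n} i → X ⊢ proj i [ v ]⇓ lookup v i
  oracle : ∀ {x} → X ⊢ oracle [ x ∷ [] ]⇓ (if X x then 1 else 0)
  comp   : ∀ {n k} {f : Program k} {gs : Vec (Program n) k} {v : Vec ℕ n}
             {w : Vec ℕ k} {y} →
           (∀ i → X ⊢ lookup gs i [ v ]⇓ lookup w i) →
           X ⊢ f [ w ]⇓ y → X ⊢ comp f gs [ v ]⇓ y
  prec-z : ∀ {n} {f : Program n} {g : Program (2 + n)} {v : Vec ℕ n} {y} →
           X ⊢ f [ v ]⇓ y → X ⊢ prec f g [ 0 ∷ v ]⇓ y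
  prec-s : ∀ {n} {f : Program n} {g : Program (2 + n)} {v : Vec ℕ n} {x y z} →
           X ⊢ prec f g [ x ∷ v ]⇓ y → X ⊢ g [ x ∷ y ∷ v ]⇓ z →
           X ⊢ prec f g [ suc x ∷ v ]⇓ z
  mu     : ∀ {n} {f : Program (1 + n)} {v : Vec ℕ n} {x} →
           X ⊢ f [ x ∷ v ]⇓ 0 →
           (∀ y → y < x → ∃[ z ] X ⊢ f [ y ∷ v ]⇓ suc z) →
           X ⊢ mu f [ v ]⇓ x

Computes : (ℕ → Bool) → Pred ℕ 0ℓ → Set
Computes X P = Σ[ c ∈ Program 1 ]
  (∀ x → (P x × X ⊢ c [ x ∷ [] ]⇓ 1) ⊎ (¬ P x × X ⊢ c [ x ∷ [] ]⇓ 0))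

-- A bijection between lists and natural numbers.
⟨_⟩ : List ℕ → ℕ
⟨ [] ⟩     = 0
⟨ x ∷ xs ⟩ = 2 ^ x * suc (2 * ⟨ xs ⟩)

-- The relation R is a strict ordering of the set D isomorphic to α.
HasOrderType : Pred ℕ 0ℓ → (ℕ → ℕ → Set) → Ord → Set
HasOrderType D R α = Σ[ f ∈ (ℕ → Ord) ]
  (∀ x → D x → f x <ᵒ α) ×
  (∀ β → β <ᵒ α → ∃[ x ] (D x × f x ≈ᵒ β)) ×
  (∀ x y → D x → D y → f x ≈ᵒ f y → x ≡ y) ×
  (∀ x y → D x → D y → R x y ⇔ f x <ᵒ f y)

ComputableOrdinal : (ℕ → Bool) → Pred Ord (lsuc 0ℓ)
ComputableOrdinal X α =
  Σ[ D ∈ Pred ℕ 0ℓ ] Σ[ R ∈ (ℕ → ℕ → Set) ]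
    Computes X D ×
    Computes X (λ z → ∃[ x ] ∃[ y ] (z ≡ ⟨ x ∷ y ∷ [] ⟩ × D x × D y × R x y)) ×
    HasOrderType D R α

Isω₁^ : (ℕ → Bool) → Pred Ord (lsuc 0ℓ)
Isω₁^ X = IsLeast (λ α → ¬ ComputableOrdinal X α)

record Vocabulary : Set₁ where
  field
    Rel Fun   : Set
    relArity  : Rel → ℕ
    funArity  : Fun → ℕ
    relCode   : Rel → ℕ
    funCode   : Fun → ℕ
    relCode-injective : Injective _≡_ _≡_ relCode
    funCode-injective : Injective _≡_ _≡_ funCode

open Vocabulary

-- Structures are countable and nonempty.
record Structure (𝓛 : Vocabulary) : Set₁ where
  field
    Carrier         : Set
    element         : Carrier
    index           : Carrier → ℕ
    index-injective : Injective _≡_ _≡_ index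
    ⟦rel⟧           : (R : Rel 𝓛) → Vec Carrier (relArity 𝓛 R) → Set
    ⟦fun⟧           : (f : Fun 𝓛) → Vec Carrier (funArity 𝓛 f) → Carrier

open Structure

record _≅_ {𝓛 : Vocabulary} (M N : Structure 𝓛) : Set where
  field
    bijection : Carrier M ↔ Carrier N
  open Inverse bijection public using (to)
  field
    rel-iso : ∀ R v → ⟦rel⟧ M R v ⇔ ⟦rel⟧ N R (mapᵛ to v)
    fun-iso : ∀ f v → to (⟦fun⟧ M f v) ≡ ⟦fun⟧ N f (mapᵛ to v)

-- The atomic diagram of the copy of M with domain the range of ι.
Diagram : {𝓛 : Vocabulary} (M : Structure 𝓛) → (Carrier M → ℕ) → Pred ℕ 0ℓ
Diagram {𝓛} M ι z =
  (∃[ x ] z ≡ ⟨ 0 ∷ ι x ∷ [] ⟩) ⊎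
  (∃[ R ] ∃[ v ] (⟦rel⟧ M R v × z ≡ ⟨ 1 ∷ relCode 𝓛 R ∷ toList (mapᵛ ι v) ⟩)) ⊎
  (∃[ f ] ∃[ v ]
    z ≡ ⟨ 2 ∷ funCode 𝓛 f ∷ ι (⟦fun⟧ M f v) ∷ toList (mapᵛ ι v) ⟩)

ComputesCopy : {𝓛 : Vocabulary} → (ℕ → Bool) → Structure 𝓛 → Set
ComputesCopy X M = Σ[ ι ∈ (Carrier M → ℕ) ]
  (Injective _≡_ _≡_ ι × Computes X (Diagram M ι))

Isω₁ : {𝓛 : Vocabulary} → Structure 𝓛 → Pred Ord (lsuc 0ℓ)
Isω₁ M = IsLeast (λ α → ∃[ X ] (ComputesCopy X M × Isω₁^ X α))

data Term (𝓛 : Vocabulary) (n : ℕ) : Set where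
  var : Fin n → Term 𝓛 n
  fun : (f : Fun 𝓛) → (Fin (funArity 𝓛 f) → Term 𝓛 n) → Term 𝓛 n

-- Formulas of L_ω₁ω whose free variables are among n de Bruijn indices.
data Formula (𝓛 : Vocabulary) : ℕ → Set where
  ⊤ᶠ   : ∀ {n} → Formula 𝓛 n
  eq   : ∀ {n} → Term 𝓛 n → Term 𝓛 n → Formula 𝓛 n
  rel  : ∀ {n} (R : Rel 𝓛) → (Fin (relArity 𝓛 R) → Term 𝓛 n) → Formula 𝓛 n
  ¬ᶠ_  : ∀ {n} → Formula 𝓛 n → Formula 𝓛 n
  _∧ᶠ_ : ∀ {n} → Formula 𝓛 n → Formula 𝓛 n → Formula 𝓛 n
  ∃ᶠ_  : ∀ {n} → Formula 𝓛 (suc n) → Formula 𝓛 n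
  ⋁ᶠ   : ∀ {n} → (ℕ → Formula 𝓛 n) → Formula 𝓛 n

infix  9 ¬ᶠ_ ∃ᶠ_ ∀ᶠ_
infixr 8 _∧ᶠ_

private variable
  𝓛 : Vocabulary

-- The dual connectives are abbreviations.  Hence a fragment containing ⋀ᶠ F
-- contains ⋁ᶠ (¬ᶠ ∘ F), so that ω-completeness, which mentions only
-- disjunctions, also governs negated conjunctions.
⊥ᶠ : Formula 𝓛 n
⊥ᶠ = ¬ᶠ ⊤ᶠ

∀ᶠ_ : Formula 𝓛 (suc n) → Formula 𝓛 n
∀ᶠ F = ¬ᶠ ∃ᶠ ¬ᶠ F

⋀ᶠ : (ℕ → Formula 𝓛 n) → Formula 𝓛 n
⋀ᶠ F = ¬ᶠ ⋁ᶠ (λ i → ¬ᶠ F i)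

Sentence : Vocabulary → Set
Sentence 𝓛 = Formula 𝓛 0

infix 4 _≈ᵗ_ _≈ᶠ_

data _≈ᵗ_ {𝓛 : Vocabulary} {n : ℕ} : Term 𝓛 n → Term 𝓛 n → Set where
  var≈ : ∀ {i} → var i ≈ᵗ var i
  fun≈ : ∀ {f ts us} → (∀ i → ts i ≈ᵗ us i) → fun f ts ≈ᵗ fun f us

-- Identity of formulas: ⋁ᶠ is applied to a countable set of formulas, so the
-- order and repetitions of an enumeration are irrelevant.
data _≈ᶠ_ {𝓛 : Vocabulary} : ∀ {n} → Formula 𝓛 n → Formula 𝓛 n → Set where
  ⊤ᶠ   : ∀ {n} → ⊤ᶠ {n = n} ≈ᶠ ⊤ᶠ
  eq   : ∀ {n} {s s′ t t′ : Term 𝓛 n} → s ≈ᵗ s′ → t ≈ᵗ t′ → eq s t ≈ᶠ eq s′ t′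
  rel  : ∀ {n R} {ts us : Fin (relArity 𝓛 R) → Term 𝓛 n} →
         (∀ i → ts i ≈ᵗ us i) → rel R ts ≈ᶠ rel R us
  ¬ᶠ_  : ∀ {n} {F F′ : Formula 𝓛 n} → F ≈ᶠ F′ → ¬ᶠ F ≈ᶠ ¬ᶠ F′
  _∧ᶠ_ : ∀ {n} {F F′ G G′ : Formula 𝓛 n} →
         F ≈ᶠ F′ → G ≈ᶠ G′ → F ∧ᶠ G ≈ᶠ F′ ∧ᶠ G′
  ∃ᶠ_  : ∀ {n} {F F′ : Formula 𝓛 (suc n)} → F ≈ᶠ F′ → ∃ᶠ F ≈ᶠ ∃ᶠ F′
  ⋁ᶠ   : ∀ {n} {F G : ℕ → Formula 𝓛 n} →
         (∀ i → ∃[ j ] F i ≈ᶠ G j) → (∀ j → ∃[ i ] F i ≈ᶠ G j) → ⋁ᶠ F ≈ᶠ ⋁ᶠ G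

substᵗ : (Fin m → Term 𝓛 n) → Term 𝓛 m → Term 𝓛 n
substᵗ σ (var i)    = σ i
substᵗ σ (fun f ts) = fun f (λ i → substᵗ σ (ts i))

lift : (Fin m → Term 𝓛 n) → Fin (suc m) → Term 𝓛 (suc n)
lift σ fzero    = var fzero
lift σ (fsuc i) = substᵗ (var ∘ fsuc) (σ i)

substᶠ : (Fin m → Term 𝓛 n) → Formula 𝓛 m → Formula 𝓛 n
substᶠ σ ⊤ᶠ         = ⊤ᶠ
substᶠ σ (eq s t)   = eq (substᵗ σ s) (substᵗ σ t)
substᶠ σ (rel R ts) = rel R (λ i → substᵗ σ (ts i))
substᶠ σ (¬ᶠ F)     = ¬ᶠ substᶠ σ F
substᶠ σ (F ∧ᶠ G)   = substᶠ σ F ∧ᶠ substᶠ σ G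
substᶠ σ (∃ᶠ F)     = ∃ᶠ substᶠ (lift σ) F
substᶠ σ (⋁ᶠ F)     = ⋁ᶠ (λ i → substᶠ σ (F i))

weaken : Formula 𝓛 n → Formula 𝓛 (suc n)
weaken = substᶠ (var ∘ fsuc)

_/0 : Term 𝓛 n → Fin (suc n) → Term 𝓛 n
(t /0) fzero    = t
(t /0) (fsuc i) = var i

closed⇒open : Sentence 𝓛 → Formula 𝓛 n
closed⇒open = substᶠ (λ ())

eval : (M : Structure 𝓛) → Vec (Carrier M) n → Term 𝓛 n → Carrier M
eval M ρ (var i)    = lookup ρ i
eval M ρ (fun f ts) = ⟦fun⟧ M f (tabulate (λ i → eval M ρ (ts i)))

infix 4 _⊨_[_] _⊨_ _⊨*_

_⊨_[_] : (M : Structure 𝓛) → Formula 𝓛 n → Vec (Carrier M) n → Set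
M ⊨ ⊤ᶠ [ ρ ]       = ⊤
M ⊨ eq s t [ ρ ]   = eval M ρ s ≡ eval M ρ t
M ⊨ rel R ts [ ρ ] = ⟦rel⟧ M R (tabulate (λ i → eval M ρ (ts i)))
M ⊨ ¬ᶠ F [ ρ ]     = ¬ (M ⊨ F [ ρ ])
M ⊨ F ∧ᶠ G [ ρ ]   = M ⊨ F [ ρ ] × M ⊨ G [ ρ ]
M ⊨ ∃ᶠ F [ ρ ]     = ∃[ x ] M ⊨ F [ x ∷ ρ ]
M ⊨ ⋁ᶠ F [ ρ ]     = ∃[ i ] M ⊨ F i [ ρ ]

_⊨_ : Structure 𝓛 → Sentence 𝓛 → Set
M ⊨ F = M ⊨ F [ [] ]

_⊨*_ : Structure 𝓛 → Pred (Sentence 𝓛) 0ℓ → Set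
M ⊨* S = ∀ F → S F → M ⊨ F

Finitary : Formula 𝓛 n → Set
Finitary ⊤ᶠ        = ⊤
Finitary (eq _ _)  = ⊤
Finitary (rel _ _) = ⊤
Finitary (¬ᶠ F)    = Finitary F
Finitary (F ∧ᶠ G)  = Finitary F × Finitary G
Finitary (∃ᶠ F)    = Finitary F
Finitary (⋁ᶠ _)    = ⊥

FinitaryQF : Formula 𝓛 n → Set
FinitaryQF ⊤ᶠ        = ⊤
FinitaryQF (eq _ _)  = ⊤
FinitaryQF (rel _ _) = ⊤
FinitaryQF (¬ᶠ F)    = FinitaryQF F
FinitaryQF (F ∧ᶠ G)  = FinitaryQF F × FinitaryQF G
FinitaryQF (∃ᶠ _)    = ⊥
FinitaryQF (⋁ᶠ _)    = ⊥

∃^ ∀^ : ∀ k → Formula 𝓛 (k + n) → Formula 𝓛 n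
∃^ zero    F = F
∃^ (suc k) F = ∃^ k (∃ᶠ F)
∀^ zero    F = F
∀^ (suc k) F = ∀^ k (∀ᶠ F)

-- Finite and empty disjunctions arise by repetition and from ⊥ᶠ.
data IsΣ {𝓛 : Vocabulary} {n : ℕ} (α : Ord) : Formula 𝓛 n → Set
data IsΠ {𝓛 : Vocabulary} {n : ℕ} (α : Ord) : Formula 𝓛 n → Set

data IsΣ {𝓛} {n} α where
  finitary-qf : ∀ {F} → α ≤ᵒ zero → FinitaryQF F → IsΣ α F
  ⋁∃          : zero <ᵒ α → (k : ℕ → ℕ) (ψ : ∀ i → Formula 𝓛 (k i + n))
                (β : ℕ → Ord) → (∀ i → β i <ᵒ α × IsΠ (β i) (ψ i)) →
                IsΣ α (⋁ᶠ (λ i → ∃^ (k i) (ψ i)))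

data IsΠ {𝓛} {n} α where
  finitary-qf : ∀ {F} → α ≤ᵒ zero → FinitaryQF F → IsΠ α F
  ⋀∀          : zero <ᵒ α → (k : ℕ → ℕ) (ψ : ∀ i → Formula 𝓛 (k i + n))
                (β : ℕ → Ord) → (∀ i → β i <ᵒ α × IsΣ (β i) (ψ i)) →
                IsΠ α (⋀ᶠ (λ i → ∀^ (k i) (ψ i)))

_≡[_]_ : Structure 𝓛 → Ord → Structure 𝓛 → Set
M ≡[ α ] N = ∀ F → IsΠ α F → M ⊨ F ⇔ N ⊨ F

-- Membership in the classes Π_β and Σ_β is up to logical equivalence.
IsQr : Sentence 𝓛 → Pred Ord (lsuc 0ℓ)
IsQr {𝓛} S = IsLeast (λ β →
  Σ[ F ∈ Sentence 𝓛 ] ((IsΠ β F ⊎ IsΣ β F) × (∀ M → M ⊨ S ⇔ M ⊨ F)))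

IsScottSentence : Structure 𝓛 → Sentence 𝓛 → Set₁
IsScottSentence M F = ∀ N → N ⊨ F ⇔ N ≅ M

IsCSR : Structure 𝓛 → Pred Ord (lsuc 0ℓ)
IsCSR {𝓛} M =
  IsLeast (λ α → Σ[ F ∈ Sentence 𝓛 ] (IsΠ (suc α) F × IsScottSentence M F))

CountablyManyModels : Pred (Structure 𝓛) p → Set (lsuc 0ℓ ⊔ p)
CountablyManyModels = AtMostCountable _≅_

-- The isomorphism types of models of φ are in bijection with the countable
-- ordinals.
HasExactlyℵ₁Models : Sentence 𝓛 → Set₁
HasExactlyℵ₁Models {𝓛} φ = Σ[ g ∈ (Ord → Structure 𝓛) ]
  (∀ α → g α ⊨ φ) ×
  (∀ α β → α ≈ᵒ β ⇔ g α ≅ g β) ×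
  (∀ M → M ⊨ φ → ∃[ α ] M ≅ g α)

SameΣType : Ord → (M N : Σ[ A ∈ Structure 𝓛 ] Vec (Carrier A) n) → Set
SameΣType α (M , v) (N , w) = ∀ F → IsΣ α F → M ⊨ F [ v ] ⇔ N ⊨ F [ w ]

-- M lies in an uncountable ≡_β-class of models of φ.
𝒞 : Sentence 𝓛 → Ord → Pred (Structure 𝓛) (lsuc 0ℓ)
𝒞 φ β M = M ⊨ φ × ¬ CountablyManyModels (λ N → N ⊨ φ × N ≡[ β ] M)

record MinimalCounterexample {𝓛 : Vocabulary} (φ : Sentence 𝓛) : Set₁ where
  field
    exactly-ℵ₁  : HasExactlyℵ₁Models φ
    scattered   : ∀ α → AtMostCountable (λ M N → M ≡[ α ] N) (λ M → M ⊨ φ)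
    minimal     : ∀ ψ → CountablyManyModels (λ M → M ⊨ φ ∧ᶠ ψ) ⊎
                        CountablyManyModels (λ M → M ⊨ φ ∧ᶠ ¬ᶠ ψ)
    few-types   : ∀ α n →
                  AtMostCountable (SameΣType {n = n} α) (λ M → proj₁ M ⊨ φ)
    unique-big-class : ∀ β → ∃[ M ] (𝒞 φ β M × (∀ N → 𝒞 φ β N → N ≡[ β ] M))

IsF : Sentence 𝓛 → Ord → Pred Ord (lsuc 0ℓ)
IsF φ α = IsLeast (λ β →
  ∀ M → M ⊨ φ → ¬ 𝒞 φ α M → ∃[ γ ] (IsCSR M γ × γ <ᵒ β))

𝔉 : Sentence 𝓛 → Pred Ord (lsuc 0ℓ)
𝔉 φ α = ∃[ β ] (IsF φ α β × β ≤ᵒ α)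

infix 4 _⊩_ _⊢_

-- Natural deduction with the finitary rules of L_ω₁ω; what is left out is
-- the elimination rule for ⋁ᶠ, which has infinitely many premises.  A
-- derivation is therefore a finite tree.  The n free variables act as
-- constants.
data _⊩_ {𝓛 : Vocabulary} : ∀ {n} → List (Formula 𝓛 n) → Formula 𝓛 n → Set where
  hyp      : ∀ {n Γ} {F : Formula 𝓛 n} → F ∈ Γ → Γ ⊩ F
  same     : ∀ {n Γ} {F G : Formula 𝓛 n} → F ≈ᶠ G → Γ ⊩ F → Γ ⊩ G
  ⊤-intro  : ∀ {n} {Γ : List (Formula 𝓛 n)} → Γ ⊩ ⊤ᶠ
  ¬-intro  : ∀ {n Γ} {F G : Formula 𝓛 n} →
             F ∷ Γ ⊩ G → F ∷ Γ ⊩ ¬ᶠ G → Γ ⊩ ¬ᶠ F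
  ¬¬-elim  : ∀ {n Γ} {F : Formula 𝓛 n} → Γ ⊩ ¬ᶠ ¬ᶠ F → Γ ⊩ F
  ∧-intro  : ∀ {n Γ} {F G : Formula 𝓛 n} → Γ ⊩ F → Γ ⊩ G → Γ ⊩ F ∧ᶠ G
  ∧-elim₁  : ∀ {n Γ} {F G : Formula 𝓛 n} → Γ ⊩ F ∧ᶠ G → Γ ⊩ F
  ∧-elim₂  : ∀ {n Γ} {F G : Formula 𝓛 n} → Γ ⊩ F ∧ᶠ G → Γ ⊩ G
  ∃-intro  : ∀ {n Γ} {F : Formula 𝓛 (suc n)} (t : Term 𝓛 n) →
             Γ ⊩ substᶠ (t /0) F → Γ ⊩ ∃ᶠ F
  ∃-elim   : ∀ {n Γ} {F : Formula 𝓛 (suc n)} {G : Formula 𝓛 n} →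
             Γ ⊩ ∃ᶠ F → F ∷ map weaken Γ ⊩ weaken G → Γ ⊩ G
  ⋁-intro  : ∀ {n Γ} {F : ℕ → Formula 𝓛 n} i → Γ ⊩ F i → Γ ⊩ ⋁ᶠ F
  eq-refl  : ∀ {n Γ} (t : Term 𝓛 n) → Γ ⊩ eq t t
  eq-subst : ∀ {n Γ} {s t : Term 𝓛 n} (F : Formula 𝓛 (suc n)) →
             Γ ⊩ eq s t → Γ ⊩ substᶠ (s /0) F → Γ ⊩ substᶠ (t /0) F
  nonempty : ∀ {n} {Γ : List (Formula 𝓛 n)} → Γ ⊩ ∃ᶠ ⊤ᶠ

_⊢_ : Pred (Formula 𝓛 n) 0ℓ → Formula 𝓛 n → Set
S ⊢ F = ∃[ Γ ] (All S Γ × Γ ⊩ F)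

Consistent : Pred (Formula 𝓛 n) 0ℓ → Set
Consistent S = ¬ (S ⊢ ⊥ᶠ)

-- Sets of formulas, listed by number of free variables.
Language : Vocabulary → Set₁
Language 𝓛 = ∀ n → Pred (Formula 𝓛 n) 0ℓ

-- The closure of B under the operations of a fragment.  As usual, fragments
-- contain all atomic formulas.
data Gen {𝓛 : Vocabulary} (B : Language 𝓛) : Language 𝓛 where
  base   : ∀ {n F} → B n F → Gen B n F
  same   : ∀ {n F G} → F ≈ᶠ G → Gen B n F → Gen B n G
  g-⊤    : ∀ {n} → Gen B n ⊤ᶠ
  g-eq   : ∀ {n} s t → Gen B n (eq s t)
  g-rel  : ∀ {n} R ts → Gen B n (rel R ts)
  g-¬    : ∀ {n F} → Gen B n F → Gen B n (¬ᶠ F)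
  g-∧    : ∀ {n F G} → Gen B n F → Gen B n G → Gen B n (F ∧ᶠ G)
  g-∃    : ∀ {n F} → Gen B (suc n) F → Gen B n (∃ᶠ F)
  subst  : ∀ {m n F} (σ : Fin m → Term 𝓛 n) → Gen B m F → Gen B n (substᶠ σ F)
  sub-¬  : ∀ {n F} → Gen B n (¬ᶠ F) → Gen B n F
  sub-∧₁ : ∀ {n F G} → Gen B n (F ∧ᶠ G) → Gen B n F
  sub-∧₂ : ∀ {n F G} → Gen B n (F ∧ᶠ G) → Gen B n G
  sub-∃  : ∀ {n F} → Gen B n (∃ᶠ F) → Gen B (suc n) F
  sub-⋁  : ∀ {n F} → Gen B n (⋁ᶠ F) → ∀ i → Gen B n (F i)

record IsFragment {𝓛 : Vocabulary} (L : Language 𝓛) : Set where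
  field
    closed    : ∀ n → Gen L n ⊆ L n
    countable : ∀ n → AtMostCountable _≈ᶠ_ (L n)

Opened : Pred (Sentence 𝓛) 0ℓ → Pred (Formula 𝓛 n) 0ℓ
Opened S F = ∃[ G ] (S G × closed⇒open G ≡ F)

-- maximal quantifies over one-formula extensions of p only, which suffices
-- because subsets of a consistent set are consistent.
record IsType {𝓛 : Vocabulary} (L : Language 𝓛) (S : Pred (Sentence 𝓛) 0ℓ)
              {n : ℕ} (p : Pred (Formula 𝓛 n) 0ℓ) : Set where
  field
    inside     : p ⊆ L n
    consistent : Consistent (Opened S ∪ p)
    maximal    : ∀ F → L n F → Consistent (Opened S ∪ (p ∪ ｛ F ｝)) → p F

Principal : Pred (Sentence 𝓛) 0ℓ → Pred (Formula 𝓛 n) 0ℓ → Set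
Principal S p = ∃[ F ] (p F × (∀ G → p G → Opened S ∪ ｛ F ｝ ⊢ G))

Enumerates : (ℕ → Formula 𝓛 n) → Pred (Formula 𝓛 n) 0ℓ → Set
Enumerates f p = p ≐ (λ F → ∃[ i ] F ≈ᶠ f i)

typeOf : (L : Language 𝓛) (A : Structure 𝓛) →
         Vec (Carrier A) n → Pred (Formula 𝓛 n) 0ℓ
typeOf L A v F = L _ F × A ⊨ F [ v ]

Th : Language 𝓛 → Structure 𝓛 → Pred (Sentence 𝓛) 0ℓ
Th L A F = L 0 F × A ⊨ F

IsAtomicModel : Language 𝓛 → Pred (Sentence 𝓛) 0ℓ → Structure 𝓛 → Set
IsAtomicModel L S A =
  A ⊨* S × (∀ n (v : Vec (Carrier A) n) → Principal S (typeOf L A v))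

RealizedConjunctions : Structure 𝓛 → Language 𝓛 → Language 𝓛
RealizedConjunctions A L n F = Σ[ v ∈ Vec (Carrier A) n ]
  (¬ Principal (Th L A) (typeOf L A v) ×
   ∃[ f ] (Enumerates f (typeOf L A v) × F ≡ ⋀ᶠ f))

Lᴬ : Structure 𝓛 → Ord → Language 𝓛
Lᴬ A zero    n = Finitary
Lᴬ A (suc δ) n = Gen (λ m → Lᴬ A δ m ∪ RealizedConjunctions A (Lᴬ A δ) m) n
Lᴬ A (lim f) n F = ∃[ i ] Lᴬ A (f i) n F

IsSacksRank : Structure 𝓛 → Pred Ord 0ℓ
IsSacksRank A = IsLeast (λ δ → IsAtomicModel (Lᴬ A δ) (Th (Lᴬ A δ) A) A)

record Theory (𝓛 : Vocabulary) : Set₁ where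
  field
    lang       : Language 𝓛
    isFragment : IsFragment lang
    thy        : Pred (Sentence 𝓛) 0ℓ
    thy⊆lang   : thy ⊆ lang 0

open Theory public

record IsωComplete {𝓛 : Vocabulary} (S : Theory 𝓛) : Set where
  field
    complete    : ∀ F → lang S 0 F → thy S F ⊎ thy S (¬ᶠ F)
    disjunction : ∀ F → thy S (⋁ᶠ F) → ∃[ i ] thy S (F i)

Generated : Sentence 𝓛 → Language 𝓛
Generated {𝓛} φ = Gen (λ n F → _≡_ {A = Σ ℕ (Formula 𝓛)} (n , F) (0 , φ))

-- Tautologies are the finitarily provable sentences of the fragment.
baseTheory : Sentence 𝓛 → Pred (Sentence 𝓛) 0ℓ
baseTheory φ F = F ≈ᶠ φ ⊎ (Generated φ 0 F × [] ⊩ F)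

NonPrincipalType : (S : Theory 𝓛) → Pred (Formula 𝓛 n) 0ℓ → Set
NonPrincipalType S p = IsType (lang S) (thy S) p × ¬ Principal (thy S) p

TypeConjunctions : Theory 𝓛 → Language 𝓛
TypeConjunctions S n F = ∃[ f ]
  (NonPrincipalType S (λ G → ∃[ i ] G ≈ᶠ f i) × F ≡ ⋀ᶠ f)

_⊑_ : Theory 𝓛 → Theory 𝓛 → Set
S ⊑ S′ = (∀ n → lang S n ⊆ lang S′ n) × thy S ⊆ thy S′

record IsUnionBelow {𝓛 : Vocabulary} (δ : Ord) (chain : Ord → Theory 𝓛)
                    (S : Theory 𝓛) : Set where
  field
    lang-union : ∀ n → lang S n ≐ (λ F → ∃[ γ ] (γ <ᵒ δ × lang (chain γ) n F))
    thy-union  : thy S ≐ (λ F → ∃[ γ ] (γ <ᵒ δ × thy (chain γ) F))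

data Node {𝓛 : Vocabulary} (φ : Sentence 𝓛) : Ord → Theory 𝓛 → Set₁ where
  root : ∀ {δ S} → δ ≈ᵒ zero →
         (∀ n → lang S n ≐ Generated φ n) → baseTheory φ ⊆ thy S →
         Consistent (thy S) → IsωComplete S → Node φ δ S
  step : ∀ {δ δ′ S S′} → Node φ δ S → δ′ ≈ᵒ suc δ →
         (∀ n → lang S′ n ≐ Gen (λ m → lang S m ∪ TypeConjunctions S m) n) →
         thy S ⊆ thy S′ →
         Consistent (thy S′) → IsωComplete S′ → Node φ δ′ S′
  limit : ∀ {δ S} → IsLimit δ → (chain : Ord → Theory 𝓛) →
          (∀ γ → γ <ᵒ δ → Node φ γ (chain γ)) →
          (∀ γ γ′ → γ ≤ᵒ γ′ → γ′ <ᵒ δ → chain γ ⊑ chain γ′) →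
          IsUnionBelow δ chain S → Node φ δ S

-- Well-founded sets as trees, up to bisimilarity _≈ᵛ_.
data V : Set₁ where
  set : (I : Set) → (I → V) → V

El : V → Set
El (set I _) = I

elem : (x : V) → El x → V
elem (set _ f) = f

infix 4 _≈ᵛ_ _∈ᵛ_

_≈ᵛ_ : V → V → Set
set I f ≈ᵛ set J g =
  (∀ i → ∃[ j ] f i ≈ᵛ g j) × (∀ j → ∃[ i ] f i ≈ᵛ g j)

_∈ᵛ_ : V → V → Set
x ∈ᵛ y = Σ[ j ∈ El y ] x ≈ᵛ elem y j

∅ᵛ : V
∅ᵛ = set ⊥ (λ ())

upair : V → V → V
upair x y = set Bool (λ b → if b then x else y)

opair : V → V → V
opair x y = upair (upair x x) (upair x y)

sucᵛ : V → V
sucᵛ x = set (Maybe (El x)) (maybe (elem x) x)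

⋃ᵛ : (I : Set) → (I → V) → V
⋃ᵛ I f = set (Σ I (El ∘ f)) (λ (i , j) → elem (f i) j)

-- The transitive closure of {x}.
trcl : V → V
trcl (set I f) =
  set (Maybe (Σ[ i ∈ I ] El (trcl (f i))))
      (maybe (λ (i , j) → elem (trcl (f i)) j) (set I f))

natᵛ : ℕ → V
natᵛ zero    = ∅ᵛ
natᵛ (suc i) = sucᵛ (natᵛ i)

ordᵛ : Ord → V
ordᵛ zero    = ∅ᵛ
ordᵛ (suc α) = sucᵛ (ordᵛ α)
ordᵛ (lim f) = ⋃ᵛ ℕ (ordᵛ ∘ f)

seqᵛ : (Fin n → V) → V
seqᵛ {n} f = set (Fin n) (λ i → opair (natᵛ (toℕ i)) (f i))

termᵛ : Term 𝓛 n → V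
termᵛ (var i)        = opair (natᵛ 0) (natᵛ (toℕ i))
termᵛ {𝓛} (fun f ts) =
  opair (natᵛ 1) (opair (natᵛ (funCode 𝓛 f)) (seqᵛ (λ i → termᵛ (ts i))))

formulaᵛ : Formula 𝓛 n → V
formulaᵛ ⊤ᶠ             = opair (natᵛ 0) ∅ᵛ
formulaᵛ (eq s t)       = opair (natᵛ 1) (opair (termᵛ s) (termᵛ t))
formulaᵛ {𝓛} (rel R ts) =
  opair (natᵛ 2) (opair (natᵛ (relCode 𝓛 R)) (seqᵛ (λ i → termᵛ (ts i))))
formulaᵛ (¬ᶠ F)         = opair (natᵛ 3) (formulaᵛ F)
formulaᵛ (F ∧ᶠ G)       = opair (natᵛ 4) (opair (formulaᵛ F) (formulaᵛ G))
formulaᵛ (∃ᶠ F)         = opair (natᵛ 5) (formulaᵛ F)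
formulaᵛ (⋁ᶠ F)         = opair (natᵛ 6) (set ℕ (λ i → formulaᵛ (F i)))

theoryᵛ : Pred (Sentence 𝓛) 0ℓ → V
theoryᵛ {𝓛} S = set (Σ (Sentence 𝓛) S) (formulaᵛ ∘ proj₁)

data SetFormula : ℕ → Set where
  _∈ˢ_ _≐ˢ_ : ∀ {n} → Fin n → Fin n → SetFormula n
  ¬ˢ_       : ∀ {n} → SetFormula n → SetFormula n
  _∧ˢ_      : ∀ {n} → SetFormula n → SetFormula n → SetFormula n
  ∃ˢ_       : ∀ {n} → SetFormula (suc n) → SetFormula n

Sat : (A : V) → SetFormula n → Vec (El A) n → Set
Sat A (i ∈ˢ j) ρ = elem A (lookup ρ i) ∈ᵛ elem A (lookup ρ j)
Sat A (i ≐ˢ j) ρ = elem A (lookup ρ i) ≈ᵛ elem A (lookup ρ j)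
Sat A (¬ˢ F)   ρ = ¬ Sat A F ρ
Sat A (F ∧ˢ G) ρ = Sat A F ρ × Sat A G ρ
Sat A (∃ˢ F)   ρ = ∃[ x ] Sat A F (x ∷ ρ)

data IsΔ₀ : ∀ {n} → SetFormula n → Set where
  δ-∈ : ∀ {n} (i j : Fin n) → IsΔ₀ (i ∈ˢ j)
  δ-≐ : ∀ {n} (i j : Fin n) → IsΔ₀ (i ≐ˢ j)
  δ-¬ : ∀ {n} {F : SetFormula n} → IsΔ₀ F → IsΔ₀ (¬ˢ F)
  δ-∧ : ∀ {n} {F G : SetFormula n} → IsΔ₀ F → IsΔ₀ G → IsΔ₀ (F ∧ˢ G)
  δ-∃ : ∀ {n} {F : SetFormula (suc n)} (i : Fin n) → IsΔ₀ F →
        IsΔ₀ (∃ˢ ((fzero ∈ˢ fsuc i) ∧ˢ F))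

data IsΣ₁ : ∀ {n} → SetFormula n → Set where
  σ-Δ₀ : ∀ {n} {F : SetFormula n} → IsΔ₀ F → IsΣ₁ F
  σ-∃  : ∀ {n} {F : SetFormula (suc n)} → IsΣ₁ F → IsΣ₁ (∃ˢ F)

-- Lists ρ of parameters from A are allowed.
Σ₁Over : (A : V) → (El A → El A → Set) → Set
Σ₁Over A R = ∃[ k ] Σ[ F ∈ SetFormula (2 + k) ] Σ[ ρ ∈ Vec (El A) k ]
  (IsΣ₁ F × (∀ x y → R x y ⇔ Sat A F (x ∷ y ∷ ρ)))

Δ₁Over : (A : V) → (El A → El A → Set) → Set
Δ₁Over A R = Σ₁Over A R × Σ₁Over A (λ x y → ¬ R x y)

Def : V → V
Def A = set (∃[ k ] (SetFormula (suc k) × Vec (El A) k))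
            (λ (_ , F , ρ) →
              set (Σ[ x ∈ El A ] Sat A F (x ∷ ρ)) (elem A ∘ proj₁))

-- 𝕃 α t is L(α, t).
𝕃 : Ord → V → V
𝕃 zero    t = trcl t
𝕃 (suc α) t = Def (𝕃 α t)
𝕃 (lim f) t = ⋃ᵛ ℕ (λ i → 𝕃 (f i) t)

𝕃ω₁ : V → V
𝕃ω₁ t = ⋃ᵛ Ord (λ α → 𝕃 α t)

-- (A , ∈) is a transitive model of Kripke–Platek set theory.
record IsΣ₁Admissible (A : V) : Set₁ where
  field
    inhabited      : El A
    transitive     : ∀ x y → x ∈ᵛ y → y ∈ᵛ A → x ∈ᵛ A
    pairing        : ∀ (x y : El A) →
      ∃[ z ] (elem A x ∈ᵛ elem A z × elem A y ∈ᵛ elem A z)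
    union          : ∀ (x : El A) → ∃[ u ]
      (∀ y z → elem A y ∈ᵛ elem A x → elem A z ∈ᵛ elem A y →
       elem A z ∈ᵛ elem A u)
    Δ₀-separation  : ∀ {k} {F : SetFormula (suc k)} → IsΔ₀ F →
      ∀ (ρ : Vec (El A) k) (x : El A) → ∃[ y ]
      (∀ z → elem A z ∈ᵛ elem A y ⇔ (elem A z ∈ᵛ elem A x × Sat A F (z ∷ ρ)))
    Δ₀-collection  : ∀ {k} {F : SetFormula (2 + k)} → IsΔ₀ F →
      ∀ (ρ : Vec (El A) k) (x : El A) →
      (∀ z → elem A z ∈ᵛ elem A x → ∃[ w ] Sat A F (z ∷ w ∷ ρ)) →
      ∃[ b ] (∀ z → elem A z ∈ᵛ elem A x →
              ∃[ w ] (elem A w ∈ᵛ elem A b × Sat A F (z ∷ w ∷ ρ)))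

𝒩 : Theory 𝓛 → Pred (Σ[ n ∈ ℕ ] Pred (Formula 𝓛 n) 0ℓ) 0ℓ
𝒩 S (n , p) = 1 ≤ n × NonPrincipalType S p

-- T-in and T-Δ₁ say that the function δ ↦ T δ is Δ₁ over L(ω₁, T).  Of the
-- club C only the listed properties are used, not how it arises from Σ₁-hulls.
record SacksData {𝓛 : Vocabulary} (φ : Sentence 𝓛) : Set₁ where
  field
    T          : Ord → Theory 𝓛
    T-node     : ∀ δ → Node φ δ (T δ)
    T-monotone : ∀ γ δ → γ ≤ᵒ δ → T γ ⊑ T δ
    T-limit    : ∀ δ → IsLimit δ → IsUnionBelow δ T (T δ)
    T-atomic   : ∀ δ → ∃[ A ]
      (IsAtomicModel (lang (T δ)) (thy (T δ)) A × IsSacksRank A δ)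

  𝕋 : V
  𝕋 = theoryᵛ (baseTheory φ)

  field
    T-in : ∀ δ → theoryᵛ (thy (T δ)) ∈ᵛ 𝕃ω₁ 𝕋
    T-Δ₁ : Δ₁Over (𝕃ω₁ 𝕋) (λ x y → ∃[ δ ]
      (elem (𝕃ω₁ 𝕋) x ≈ᵛ ordᵛ δ × elem (𝕃ω₁ 𝕋) y ≈ᵛ theoryᵛ (thy (T δ))))

    C            : Pred Ord 0ℓ
    C-club       : IsClub C
    C-above-ω    : ∀ κ → C κ → ω <ᵒ κ
    C-admissible : ∀ κ → C κ → IsΣ₁Admissible (𝕃 κ 𝕋)
    C-nonempty   : ∀ κ → C κ → ∃[ np ] 𝒩 (T κ) np
    C-countable  : ∀ κ → C κ → ∀ n → 1 ≤ n →
                   AtMostCountable _≐_ (NonPrincipalType {n = n} (T κ))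

module _ {𝓛 : Vocabulary} {φ : Sentence 𝓛} (D : SacksData φ) where
  open SacksData D

  S° : Pred Ord (lsuc 0ℓ)
  S° κ = 𝔉 φ κ × C κ × ∃[ β ] (IsQr φ β × β <ᵒ κ)

  FiberModel : Ord → Pred (Structure 𝓛) (lsuc 0ℓ)
  FiberModel κ M = M ⊨* thy (T κ) × Isω₁ M κ

  trace : Ord → Structure 𝓛 → Pred (Σ[ n ∈ ℕ ] Pred (Formula 𝓛 n) 0ℓ) 0ℓ
  trace κ M (n , p) =
    𝒩 (T κ) (n , p) × (Σ[ v ∈ Vec (Carrier M) n ] (∀ F → p F → M ⊨ F [ v ]))

  Spec : Ord → Pred (Pred (Σ[ n ∈ ℕ ] Pred (Formula 𝓛 n) 0ℓ) 0ℓ) (lsuc 0ℓ)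
  Spec κ t = ∃[ M ] (FiberModel κ M × t ≐ trace κ M)

{-# OPTIONS --safe #-}

-- Realizing a type p of T κ is expressed by the L_ω₁ω sentence ∃x̄ ⋀p, since p
-- is a subset of a countable fragment.  There are only countably many
-- non-principal types, so the complexities of these sentences are bounded by
-- some countable ordinal δ, and ≡_δ-equivalent models have the same trace.
-- Scatteredness at level δ leaves only countably many traces.
module Submission where

open import Defs
open import Level using (Level; 0ℓ)
open import Axiom.ExcludedMiddle using (ExcludedMiddle)
open import Data.Empty using (⊥-elim)
open import Data.Maybe using (Maybe; just; nothing; maybe)
open import Data.Maybe.Relation.Unary.Any as Any using (Any; just)
open import Data.Nat using (ℕ; zero; suc; _+_; z≤n; s≤s)
open import Data.Product using (Σ; ∃-syntax; Σ-syntax; _×_; _,_; proj₁; proj₂)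
open import Data.Sum using (inj₁)
open import Data.Unit using (tt)
open import Data.Vec using (Vec; []; _∷_)
open import Data.Vec.Properties using (tabulate-cong)
open import Function using (_⇔_; mk⇔; Equivalence; _∘_)
open import Function.Properties.Equivalence using (⇔-isEquivalence)
open import Relation.Binary using (Rel; IsEquivalence)
open import Relation.Binary.PropositionalEquality using (_≡_; refl; cong; sym; trans)
open import Relation.Nullary using (¬_; Dec; yes; no)
open import Relation.Nullary.Decidable using (decidable-stable)
open import Relation.Unary using (Pred; _⊆_; _≐_)

open Structure
private module ⇔ = IsEquivalence (⇔-isEquivalence {0ℓ})

private variable
  a b p q r s t : Level
  n : ℕ
  𝓛 : Vocabulary
  α β : Ord

-- Order on ordinal notations.

≤ᵒ-lim : ∀ α {f : ℕ → Ord} i → α ≤ᵒ f i → α ≤ᵒ lim f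
≤ᵒ-lim zero    i _   = tt
≤ᵒ-lim (suc α) i α<f = i , α<f
≤ᵒ-lim (lim g) i g≤f = λ j → ≤ᵒ-lim (g j) i (g≤f j)

≤ᵒ-refl : ∀ α → α ≤ᵒ α
≤ᵒ-refl zero    = tt
≤ᵒ-refl (suc α) = ≤ᵒ-refl α
≤ᵒ-refl (lim f) = λ i → ≤ᵒ-lim (f i) i (≤ᵒ-refl (f i))

-- Supplies the positivity premise of `⋁∃` and `⋀∀` from any index lying below the level.
<ᵒ⇒0<ᵒ : ∀ β → α <ᵒ β → zero <ᵒ β
<ᵒ⇒0<ᵒ (suc β) _         = tt
<ᵒ⇒0<ᵒ (lim f) (i , α<f) = i , <ᵒ⇒0<ᵒ (f i) α<f

-- Logical equivalence of formulas.

eval-cong : (M : Structure 𝓛) (ρ : Vec (Carrier M) n) {t u : Term 𝓛 n} →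
           t ≈ᵗ u → eval M ρ t ≡ eval M ρ u
eval-cong M ρ var≈             = refl
eval-cong M ρ (fun≈ {f = f} e) =
  cong (⟦fun⟧ M f) (tabulate-cong (λ i → eval-cong M ρ (e i)))

infix 4 _⟺_

-- A record rather than a function, so that F and G can be inferred.
record _⟺_ {𝓛 : Vocabulary} {n : ℕ} (F G : Formula 𝓛 n) : Set₁ where
  constructor equiv
  field
    sat : (M : Structure 𝓛) (ρ : Vec (Carrier M) n) → M ⊨ F [ ρ ] ⇔ M ⊨ G [ ρ ]

  to : ∀ {M ρ} → M ⊨ F [ ρ ] → M ⊨ G [ ρ ]
  to = Equivalence.to (sat _ _)

  from : ∀ {M ρ} → M ⊨ G [ ρ ] → M ⊨ F [ ρ ]
  from = Equivalence.from (sat _ _)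

open _⟺_

⟺-refl : {F : Formula 𝓛 n} → F ⟺ F
⟺-refl .sat M ρ = ⇔.refl

⟺-sym : {F G : Formula 𝓛 n} → F ⟺ G → G ⟺ F
⟺-sym e .sat M ρ = ⇔.sym (e .sat M ρ)

⟺-trans : {F G H : Formula 𝓛 n} → F ⟺ G → G ⟺ H → F ⟺ H
⟺-trans e e′ .sat M ρ = ⇔.trans (e .sat M ρ) (e′ .sat M ρ)

¬-cong : {F G : Formula 𝓛 n} → F ⟺ G → ¬ᶠ F ⟺ ¬ᶠ G
¬-cong e .sat M ρ = mk⇔ (_∘ from e) (_∘ to e)

∧-cong : {F F′ G G′ : Formula 𝓛 n} → F ⟺ F′ → G ⟺ G′ → F ∧ᶠ G ⟺ F′ ∧ᶠ G′
∧-cong e e′ .sat M ρ =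
  mk⇔ (λ (x , y) → to e x , to e′ y) (λ (x , y) → from e x , from e′ y)

∃-cong : {F G : Formula 𝓛 (suc n)} → F ⟺ G → ∃ᶠ F ⟺ ∃ᶠ G
∃-cong e .sat M ρ = mk⇔ (λ (x , h) → x , to e h) (λ (x , h) → x , from e h)

⋁-cong : {F G : ℕ → Formula 𝓛 n} → (∀ i → F i ⟺ G i) → ⋁ᶠ F ⟺ ⋁ᶠ G
⋁-cong e .sat M ρ =
  mk⇔ (λ (i , h) → i , to (e i) h) (λ (i , h) → i , from (e i) h)

⋀-cong : {F G : ℕ → Formula 𝓛 n} → (∀ i → F i ⟺ G i) → ⋀ᶠ F ⟺ ⋀ᶠ G
⋀-cong e = ¬-cong (⋁-cong (λ i → ¬-cong (e i)))

∃^-cong : ∀ k {F G : Formula 𝓛 (k + n)} → F ⟺ G → ∃^ k F ⟺ ∃^ k G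
∃^-cong zero    e = e
∃^-cong (suc k) e = ∃^-cong k (∃-cong e)

∀^-cong : ∀ k {F G : Formula 𝓛 (k + n)} → F ⟺ G → ∀^ k F ⟺ ∀^ k G
∀^-cong zero    e = e
∀^-cong (suc k) e = ∀^-cong k (¬-cong (∃-cong (¬-cong e)))

≈ᶠ⇒⟺ : {F G : Formula 𝓛 n} → F ≈ᶠ G → F ⟺ G
≈ᶠ⇒⟺ ⊤ᶠ        = ⟺-refl
≈ᶠ⇒⟺ (eq e e′) = equiv λ M ρ →
  mk⇔ (λ h → trans (sym (eval-cong M ρ e)) (trans h (eval-cong M ρ e′)))
      (λ h → trans (eval-cong M ρ e) (trans h (sym (eval-cong M ρ e′))))
≈ᶠ⇒⟺ (rel {R = R} e) = equiv λ M ρ →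
  ⇔.reflexive (cong (⟦rel⟧ M R) (tabulate-cong (λ i → eval-cong M ρ (e i))))
≈ᶠ⇒⟺ (¬ᶠ e)    = ¬-cong (≈ᶠ⇒⟺ e)
≈ᶠ⇒⟺ (e ∧ᶠ e′) = ∧-cong (≈ᶠ⇒⟺ e) (≈ᶠ⇒⟺ e′)
≈ᶠ⇒⟺ (∃ᶠ e)    = ∃-cong (≈ᶠ⇒⟺ e)
≈ᶠ⇒⟺ (⋁ᶠ e e′) = equiv λ M ρ →
  mk⇔ (λ (i , h) → let j , d = e  i in j , to (≈ᶠ⇒⟺ d) h)
      (λ (j , h) → let i , d = e′ j in i , from (≈ᶠ⇒⟺ d) h)

⋁-const : {F : Formula 𝓛 n} → ⋁ᶠ (λ _ → F) ⟺ F
⋁-const .sat M ρ = mk⇔ proj₂ (0 ,_)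

-- The classes Π and Σ up to equivalence.

pair : Formula 𝓛 n → Formula 𝓛 n → ℕ → Formula 𝓛 n
pair F G zero    = F
pair F G (suc _) = G

-- `IsΠ` and `IsΣ` prescribe the outermost shape of a formula, which most formulas lack; closing
-- under `⟺` makes the classes usable for all of them.
HasΠ HasΣ : Ord → Formula 𝓛 n → Set₁
HasΠ {𝓛} {n} α F = Σ[ G ∈ Formula 𝓛 n ] (IsΠ α G × F ⟺ G)
HasΣ {𝓛} {n} α F = Σ[ G ∈ Formula 𝓛 n ] (IsΣ α G × F ⟺ G)

HasΠ-resp : {F G : Formula 𝓛 n} → F ⟺ G → HasΠ α G → HasΠ α F
HasΠ-resp e (H , π , e′) = H , π , ⟺-trans e e′

HasΣ-⋁∃ : {k : ℕ → ℕ} {F : ∀ i → Formula 𝓛 (k i + n)} {β : ℕ → Ord} →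
          (∀ i → β i <ᵒ α) → (∀ i → HasΠ (β i) (F i)) →
          HasΣ α (⋁ᶠ (λ i → ∃^ (k i) (F i)))
HasΣ-⋁∃ {α = α} {k = k} β<α h =
  _ , ⋁∃ (<ᵒ⇒0<ᵒ α (β<α 0)) k (proj₁ ∘ h) _
         (λ i → β<α i , proj₁ (proj₂ (h i))) ,
  ⋁-cong (λ i → ∃^-cong (k i) (proj₂ (proj₂ (h i))))

HasΠ-⋀∀ : {k : ℕ → ℕ} {F : ∀ i → Formula 𝓛 (k i + n)} {β : ℕ → Ord} →
          (∀ i → β i <ᵒ α) → (∀ i → HasΣ (β i) (F i)) →
          HasΠ α (⋀ᶠ (λ i → ∀^ (k i) (F i)))
HasΠ-⋀∀ {α = α} {k = k} β<α h =
  _ , ⋀∀ (<ᵒ⇒0<ᵒ α (β<α 0)) k (proj₁ ∘ h) _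
         (λ i → β<α i , proj₁ (proj₂ (h i))) ,
  ⋀-cong (λ i → ∀^-cong (k i) (proj₂ (proj₂ (h i))))

-- `F` is equivalent to a constant disjunction over empty quantifier blocks.
Π⇒Σ : {F : Formula 𝓛 n} → β <ᵒ α → HasΠ β F → HasΣ α F
Π⇒Σ β<α h =
  let G , σ , e = HasΣ-⋁∃ {k = λ _ → 0} (λ _ → β<α) (λ _ → h)
  in  G , σ , ⟺-trans (⟺-sym ⋁-const) e

-- Closures, countable classes and nodes.

∃closure : Formula 𝓛 n → Sentence 𝓛
∃closure {n = zero}  F = F
∃closure {n = suc n} F = ∃closure (∃ᶠ F)

⊨-∃closure : (M : Structure 𝓛) (F : Formula 𝓛 n) →
             M ⊨ ∃closure F ⇔ (∃[ v ] M ⊨ F [ v ])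
⊨-∃closure {n = zero}  M F = mk⇔ ([] ,_) (λ { ([] , h) → h })
⊨-∃closure {n = suc n} M F =
  ⇔.trans (⊨-∃closure M (∃ᶠ F))
          (mk⇔ (λ (v , x , h) → x ∷ v , h) (λ { (x ∷ v , h) → v , x , h }))

countable-coarsen : {A : Set a} {_~_ : Rel A r} {_≈_ : Rel A s} {P : Pred A p} →
           (∀ {x y} → x ~ y → x ≈ y) →
           AtMostCountable _~_ P → AtMostCountable _≈_ P
countable-coarsen ~⇒≈ (e , covers) = e , λ x Px →
  let i , h = covers x Px in i , Any.map ~⇒≈ h

≈ᵗ-refl : (t : Term 𝓛 n) → t ≈ᵗ t
≈ᵗ-refl (var i)    = var≈
≈ᵗ-refl (fun f ts) = fun≈ (λ i → ≈ᵗ-refl (ts i))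

≈ᶠ-refl : (F : Formula 𝓛 n) → F ≈ᶠ F
≈ᶠ-refl ⊤ᶠ         = ⊤ᶠ
≈ᶠ-refl (eq s t)   = eq (≈ᵗ-refl s) (≈ᵗ-refl t)
≈ᶠ-refl (rel R ts) = rel (λ i → ≈ᵗ-refl (ts i))
≈ᶠ-refl (¬ᶠ F)     = ¬ᶠ ≈ᶠ-refl F
≈ᶠ-refl (F ∧ᶠ G)   = ≈ᶠ-refl F ∧ᶠ ≈ᶠ-refl G
≈ᶠ-refl (∃ᶠ F)     = ∃ᶠ ≈ᶠ-refl F
≈ᶠ-refl (⋁ᶠ F)     = ⋁ᶠ (λ i → i , ≈ᶠ-refl (F i)) (λ i → i , ≈ᶠ-refl (F i))

-- `φ` enters at the root and theories only grow along a branch; at a limit, level `zero` already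
-- provides it.
Node⇒φ∈ : {φ : Sentence 𝓛} {δ : Ord} {S : Theory 𝓛} → Node φ δ S → thy S φ
Node⇒φ∈ (root _ _ base⊆ _ _)          = base⊆ (inj₁ (≈ᶠ-refl _))
Node⇒φ∈ (step N _ _ thy⊆ _ _)         = thy⊆ (Node⇒φ∈ N)
Node⇒φ∈ (limit (0<δ , _) c node _ U) =
  proj₂ (IsUnionBelow.thy-union U) (zero , 0<δ , Node⇒φ∈ (node zero 0<δ))

-- Every formula lies in some class Π.

module Classical (em : ∀ ℓ → ExcludedMiddle ℓ) where

  private
    dne : {A : Set a} → ¬ ¬ A → A
    dne {a} = decidable-stable (em a)

  ¬¬⟺ : {F : Formula 𝓛 n} → ¬ᶠ ¬ᶠ F ⟺ F
  ¬¬⟺ .sat M ρ = mk⇔ dne (λ h k → k h)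

  ⊨-⋀ : (M : Structure 𝓛) (F : ℕ → Formula 𝓛 n) (ρ : Vec (Carrier M) n) →
        M ⊨ ⋀ᶠ F [ ρ ] ⇔ (∀ i → M ⊨ F i [ ρ ])
  ⊨-⋀ M F ρ = mk⇔ (λ h i → dne (λ k → h (i , k))) (λ { h (i , k) → k (h i) })

  ⋀-const : {F : Formula 𝓛 n} → ⋀ᶠ (λ _ → F) ⟺ F
  ⋀-const = ⟺-trans (¬-cong ⋁-const) ¬¬⟺

  ¬⋁⟺⋀¬ : {F : ℕ → Formula 𝓛 n} → ¬ᶠ ⋁ᶠ F ⟺ ⋀ᶠ (λ i → ¬ᶠ F i)
  ¬⋁⟺⋀¬ = ¬-cong (⋁-cong (λ i → ⟺-sym ¬¬⟺))

  ¬∃⟺∀¬ : {F : Formula 𝓛 (suc n)} → ¬ᶠ ∃ᶠ F ⟺ ∀ᶠ ¬ᶠ F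
  ¬∃⟺∀¬ = ¬-cong (∃-cong (⟺-sym ¬¬⟺))

  ∧⟺⋀ : {F G : Formula 𝓛 n} → F ∧ᶠ G ⟺ ⋀ᶠ (pair F G)
  ∧⟺⋀ {F = F} {G} .sat M ρ = ⇔.trans
    (mk⇔ (λ { (x , y) zero → x ; (x , y) (suc _) → y }) (λ h → h 0 , h 1))
    (⇔.sym (⊨-⋀ M (pair F G) ρ))

  ¬∧⟺⋁¬ : {F G : Formula 𝓛 n} → ¬ᶠ (F ∧ᶠ G) ⟺ ⋁ᶠ (pair (¬ᶠ F) (¬ᶠ G))
  ¬∧⟺⋁¬ {F = F} {G} = ⟺-trans (¬-cong ∧⟺⋀) (⟺-trans ¬¬⟺ (⋁-cong ¬pair))
    where
    ¬pair : ∀ i → ¬ᶠ pair F G i ⟺ pair (¬ᶠ F) (¬ᶠ G) i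
    ¬pair zero    = ⟺-refl
    ¬pair (suc _) = ⟺-refl

  Σ⇒Π : {F : Formula 𝓛 n} → β <ᵒ α → HasΣ β F → HasΠ α F
  Σ⇒Π β<α h =
    HasΠ-resp (⟺-sym ⋀-const) (HasΠ-⋀∀ {k = λ _ → 0} (λ _ → β<α) (λ _ → h))

  -- A quantifier-free formula does not have the shape of a formula of positive level, so levels are
  -- not literally cumulative. The detour through Σ at `suc β` treats all `β` alike, at the price of
  -- one extra successor.
  HasΠ-raise : {F : Formula 𝓛 n} → suc β <ᵒ α → HasΠ β F → HasΠ α F
  HasΠ-raise {β = β} sβ<α h = Σ⇒Π sβ<α (Π⇒Σ (≤ᵒ-refl β) h)

  private
    SomeΠ : Formula 𝓛 n → Set₁
    SomeΠ F = ∃[ α ] HasΠ α F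

    SomeΠ-resp : {F G : Formula 𝓛 n} → F ⟺ G → SomeΠ G → SomeΠ F
    SomeΠ-resp e (α , h) = α , HasΠ-resp e h

    bound : (ℕ → Ord) → Ord
    -- The successor makes the bound strict even when the supremum is attained.
    bound β = suc (lim β)

    <-bound : (β : ℕ → Ord) → ∀ i → β i <ᵒ bound β
    <-bound β i = ≤ᵒ-lim (β i) i (≤ᵒ-refl (β i))

    SomeΠ-⋁∃ : {k : ℕ → ℕ} {F : ∀ i → Formula 𝓛 (k i + n)} →
               (∀ i → SomeΠ (F i)) → SomeΠ (⋁ᶠ (λ i → ∃^ (k i) (F i)))
    SomeΠ-⋁∃ {k = k} h = suc γ ,
      Σ⇒Π (≤ᵒ-refl γ) (HasΣ-⋁∃ {k = k} (<-bound (proj₁ ∘ h)) (proj₂ ∘ h))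
      where
      γ = bound (proj₁ ∘ h)

    SomeΠ-⋀∀ : {k : ℕ → ℕ} {F : ∀ i → Formula 𝓛 (k i + n)} →
               (∀ i → SomeΠ (F i)) → SomeΠ (⋀ᶠ (λ i → ∀^ (k i) (F i)))
    SomeΠ-⋀∀ {k = k} h = bound γ ,
      HasΠ-⋀∀ {k = k} (<-bound γ)
        -- The conjuncts must be Σ, which costs one successor each; hence `γ` consists of
        -- successors.
        (λ i → Π⇒Σ (≤ᵒ-refl (proj₁ (h i))) (proj₂ (h i)))
      where
      γ = λ i → suc (proj₁ (h i))

    SomeΠ-qf : {F : Formula 𝓛 n} → FinitaryQF F → SomeΠ F × SomeΠ (¬ᶠ F)
    SomeΠ-qf qf = (zero , _ , finitary-qf tt qf , ⟺-refl) ,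
                  (zero , _ , finitary-qf tt qf , ⟺-refl)

    -- Negation is primitive and exchanges Π and Σ, so the induction carries `F` and `¬ᶠ F`
    -- together; the case of `¬ᶠ` then just swaps the two halves.
    SomeΠ-± : (F : Formula 𝓛 n) → SomeΠ F × SomeΠ (¬ᶠ F)
    SomeΠ-± ⊤ᶠ         = SomeΠ-qf tt
    SomeΠ-± (eq s t)   = SomeΠ-qf tt
    SomeΠ-± (rel R ts) = SomeΠ-qf tt
    SomeΠ-± (¬ᶠ F)     =
      let h⁺ , h⁻ = SomeΠ-± F in h⁻ , SomeΠ-resp ¬¬⟺ h⁺
    SomeΠ-± (F ∧ᶠ G)   =
      let f⁺ , f⁻ = SomeΠ-± F
          g⁺ , g⁻ = SomeΠ-± G
      in SomeΠ-resp ∧⟺⋀ (SomeΠ-⋀∀ {k = λ _ → 0} λ { zero → f⁺ ; (suc _) → g⁺ }) ,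
         SomeΠ-resp ¬∧⟺⋁¬ (SomeΠ-⋁∃ {k = λ _ → 0} λ { zero → f⁻ ; (suc _) → g⁻ })
    SomeΠ-± (∃ᶠ F)     =
      let h⁺ , h⁻ = SomeΠ-± F
      -- A single quantifier is a constant family with quantifier blocks of length one.
      in SomeΠ-resp (⟺-sym ⋁-const) (SomeΠ-⋁∃ {k = λ _ → 1} (λ _ → h⁺)) ,
         SomeΠ-resp (⟺-trans ¬∃⟺∀¬ (⟺-sym ⋀-const))
           (SomeΠ-⋀∀ {k = λ _ → 1} (λ _ → h⁻))
    SomeΠ-± (⋁ᶠ F)     =
      SomeΠ-⋁∃ {k = λ _ → 0} (λ i → proj₁ (SomeΠ-± (F i))) ,
      SomeΠ-resp ¬⋁⟺⋀¬ (SomeΠ-⋀∀ {k = λ _ → 0} (λ i → proj₂ (SomeΠ-± (F i))))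

  -- Some α such that F is Π_α up to equivalence, not the least one.
  Πrank : Formula 𝓛 n → Ord
  Πrank F = proj₁ (proj₁ (SomeΠ-± F))

  HasΠ-Πrank : (F : Formula 𝓛 n) → HasΠ (Πrank F) F
  HasΠ-Πrank F = proj₂ (proj₁ (SomeΠ-± F))

  ≡[]⇒⊨⇔ : {M N : Structure 𝓛} (F : Sentence 𝓛) → suc (Πrank F) <ᵒ α →
           M ≡[ α ] N → M ⊨ F ⇔ N ⊨ F
  ≡[]⇒⊨⇔ {M = M} {N} F r<α M≡N =
    let G , π , e = HasΠ-raise r<α (HasΠ-Πrank F)
    in  ⇔.trans (e .sat M []) (⇔.trans (M≡N G π) (⇔.sym (e .sat N [])))

  -- Transfer of countability, and realization of types as a sentence.

  -- R y x says that the equivalence class of x represents y.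
  countable-via : {A : Set a} {B : Set b} {_~_ : Rel A r} {_≈_ : Rel B s}
    {P : Pred A p} {Q : Pred B q} (R : B → A → Set t) →
    (∀ y → Q y → ∃[ x ] (P x × (∀ {x′} → x ~ x′ → R y x′))) →
    (∀ {y y′ x} → R y x → R y′ x → y ≈ y′) →
    AtMostCountable _~_ P → AtMostCountable _≈_ Q
  countable-via {A = A} {B} {_~_} {_≈_} {P} {Q} R rep inj (e , covers) =
    (λ i → choose (e i)) , λ y Qy →
      let x , Px , R-x = rep y Qy
          i , x~ = covers x Px
      in i , covered Qy R-x x~
    where
    decide : ∀ x → Dec (∃[ y ] (Q y × R y x))
    decide x = em _

    choose : Maybe (Σ A P) → Maybe (Σ B Q)
    choose nothing        = nothing
    choose (just (x , _)) with decide x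
    ... | yes (y , Qy , _) = just (y , Qy)
    ... | no _             = nothing

    covered : ∀ {x y m} → Q y → (∀ {x′} → x ~ x′ → R y x′) →
              Any (λ z → x ~ proj₁ z) m → Any (λ z → y ≈ proj₁ z) (choose m)
    covered {m = just (x′ , _)} Qy R-x (just x~x′) with decide x′
    -- The chosen element may differ from `y`, but both are represented by `x′`, so `inj` identifies
    -- them.
    ... | yes (_ , _ , R′) = just (inj (R-x x~x′) R′)
    ... | no ∄y            = ⊥-elim (∄y (_ , Qy , R-x x~x′))

  -- Semantic rather than syntactic equivalence, as it is visibly transitive.
  countable-⊆ : {L P : Pred (Formula 𝓛 n) 0ℓ} → P ⊆ L →
                AtMostCountable _⟺_ L → AtMostCountable _⟺_ P
  countable-⊆ P⊆L = countable-via _⟺_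
    (λ F PF → F , P⊆L PF , λ e → e)
    (λ e e′ → ⟺-trans e (⟺-sym e′))

  -- The enumerated members of `P` represent all of `P` up to `⟺`, and satisfaction respects `⟺`.
  conjunction : {P : Pred (Formula 𝓛 n) 0ℓ} → AtMostCountable _⟺_ P →
    Σ[ G ∈ Formula 𝓛 n ]
      (∀ M v → M ⊨ G [ v ] ⇔ (∀ F → P F → M ⊨ F [ v ]))
  conjunction {𝓛 = 𝓛} {n} {P} (e , covers) = ⋀ᶠ conjuncts , λ M v →
    ⇔.trans (⊨-⋀ M conjuncts v)
      (mk⇔ (λ h F PF → let i , F⟺ = covers F PF in elim M v F⟺ (h i))
           (λ h i → intro M v h (e i)))
    where
    conjunct : Maybe (Σ (Formula 𝓛 n) P) → Formula 𝓛 n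
    -- Gaps in the enumeration become `⊤ᶠ`, which imposes no condition.
    conjunct = maybe proj₁ ⊤ᶠ

    conjuncts : ℕ → Formula 𝓛 n
    conjuncts i = conjunct (e i)

    elim : ∀ M v {F m} → Any (λ G → F ⟺ proj₁ G) m →
           M ⊨ conjunct m [ v ] → M ⊨ F [ v ]
    elim M v (just e) = from e

    intro : ∀ M v → (∀ F → P F → M ⊨ F [ v ]) → ∀ m → M ⊨ conjunct m [ v ]
    intro M v h nothing         = tt
    intro M v h (just (F , PF)) = h F PF

  Realizes : (M : Structure 𝓛) → Pred (Formula 𝓛 n) 0ℓ → Set
  Realizes {n = n} M P = Σ[ v ∈ Vec (Carrier M) n ] (∀ F → P F → M ⊨ F [ v ])

  realization : (S : Theory 𝓛) {P : Pred (Formula 𝓛 n) 0ℓ} → P ⊆ lang S n →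
                Σ[ F ∈ Sentence 𝓛 ] (∀ M → M ⊨ F ⇔ Realizes M P)
  realization {n = n} S P⊆L =
    let ⋀P , ⊨⋀P = conjunction (countable-⊆ P⊆L
                     (countable-coarsen ≈ᶠ⇒⟺ (IsFragment.countable (isFragment S) n)))
    in ∃closure ⋀P , λ M → ⇔.trans (⊨-∃closure M ⋀P)
         (mk⇔ (λ (v , h) → v , Equivalence.to (⊨⋀P M v) h)
              (λ (v , h) → v , Equivalence.from (⊨⋀P M v) h))

  -- A level of equivalence that determines traces.

  module _ {𝓛 : Vocabulary} {φ : Sentence 𝓛} (D : SacksData φ)
           {κ : Ord} (Cκ : SacksData.C D κ) where
    open SacksData D

    private
      -- The arity is shifted by one because traces contain only types in at least one variable.
      NPT : ℕ → Set₁
      NPT n = Σ (Pred (Formula 𝓛 (suc n)) 0ℓ) (NonPrincipalType (T κ))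

      realizationOf : ∀ {n} (P : NPT n) →
        Σ[ F ∈ Sentence 𝓛 ] (∀ M → M ⊨ F ⇔ Realizes M (proj₁ P))
      realizationOf (_ , t , _) = realization (T κ) (IsType.inside t)

      types : ∀ n → AtMostCountable _≐_ (NonPrincipalType {n = suc n} (T κ))
      types n = C-countable κ Cκ (suc n) (s≤s z≤n)

      sentence : ∀ {n} → Maybe (NPT n) → Sentence 𝓛
      sentence = maybe (proj₁ ∘ realizationOf) ⊤ᶠ

      sentences : ℕ → ℕ → Sentence 𝓛
      sentences n i = sentence (proj₁ (types n) i)

    traceBound : Ord
    -- One successor is the margin of `HasΠ-raise`, the other makes the inequality strict.
    traceBound = lim λ n → lim λ i → suc (suc (Πrank (sentences n i)))

    ≡[]⇒trace⊆ : {M N : Structure 𝓛} → M ≡[ traceBound ] N →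
                 trace D κ M ⊆ trace D κ N
    ≡[]⇒trace⊆ {M} {N} M≡N {suc n , P} ((s≤s z≤n , t) , r) =
      -- `P` need not be enumerated itself, only a type with the same elements; `transfer` passes
      -- through the sentence of that type.
      let i , P≐ = proj₂ (types n) P t
      in (s≤s z≤n , t) ,
         transfer P≐
           (≡[]⇒⊨⇔ (sentences n i) (n , i , ≤ᵒ-refl (Πrank (sentences n i))) M≡N)
           r
      where
      transfer : ∀ {m : Maybe (NPT n)} → Any (λ Q → P ≐ proj₁ Q) m →
                 M ⊨ sentence m ⇔ N ⊨ sentence m → Realizes M P → Realizes N P
      transfer {just Q} (just (P⊆Q , Q⊆P)) M⇔N (v , h) =
        let F⇔ = proj₂ (realizationOf Q)
            w , k = Equivalence.to (F⇔ N) (Equivalence.to M⇔N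
                      (Equivalence.from (F⇔ M) (v , λ F QF → h F (Q⊆P QF))))
        in w , λ F PF → k F (P⊆Q PF)

    ≡[]⇒trace≐ : {M N : Structure 𝓛} → M ≡[ traceBound ] N →
                 trace D κ M ≐ trace D κ N
    ≡[]⇒trace≐ {M} {N} M≡N =
      ≡[]⇒trace⊆ {M} {N} M≡N , ≡[]⇒trace⊆ {N} {M} (λ F π → ⇔.sym (M≡N F π))

mainTheorem8 : (∀ (ℓ : Level) → ExcludedMiddle ℓ) →
    (𝓛 : Vocabulary) (φ : Sentence 𝓛) → MinimalCounterexample φ →
    (D : SacksData φ) (κ : Ord) → S° D κ →
    AtMostCountable _≐_ (Spec D κ)
mainTheorem8 em 𝓛 φ mc D κ (_ , Cκ , _) =
  -- A class of models of `φ` represents the common trace of its members. The enumerated member need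
  -- not be a fiber model: only its trace is compared with `t`.
  countable-via (λ t M → t ≐ trace D κ M) modelOf same-trace
    (MinimalCounterexample.scattered mc δ)
  where
  open Classical em

  δ : Ord
  δ = traceBound D Cκ

  modelOf : ∀ t → Spec D κ t → ∃[ M ] (M ⊨ φ ×
              (∀ {N} → M ≡[ δ ] N → t ≐ trace D κ N))
  modelOf t (M , (M⊨T , _) , t⊆ , ⊆t) =
    M , M⊨T φ (Node⇒φ∈ (SacksData.T-node D κ)) , λ {N} M≡N →
      let M⊆N , N⊆M = ≡[]⇒trace≐ D Cκ {M} {N} M≡N
      in (λ x → M⊆N (t⊆ x)) , (λ x → ⊆t (N⊆M x))

  same-trace : ∀ {t u M} → t ≐ trace D κ M → u ≐ trace D κ M → t ≐ u
  same-trace (t⊆ , ⊆t) (u⊆ , ⊆u) = (λ x → ⊆u (t⊆ x)) , (λ x → ⊆t (u⊆ x))
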